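{- Let $G$ be a topological group, let $\mathfrak E$ be a $G$-spectrum, let $\mathfrak M$ be a Mackey cover of $\mathfrak E$ and let $C:\mathfrak M\to\mathsf{TAb}$ be a Mackey functor. Then the map $\mathrm{ind}^C_{\mathfrak E}:(H,U)\mapsto\mathrm{ind}^C_{H,U}C(U)$ ($(H,U)\in\mathfrak E_{\mathrm b}$) is a subfunctor of $C^{\mathfrak E}\in\mathsf{Fct}(\mathfrak E,\mathsf{TAb})$, and consequently $C^{\mathfrak E}/\mathrm{ind}^C_{\mathfrak E}$ is a representation of $\mathfrak E$.
   Context: $\mathsf{TAb}$ is the category of topological abelian groups. ${}^gH=gHg^{ -1}$, $H^g=g^{ -1}Hg$. RIC-functors. A RIC-domain $\mathfrak D$ consists of a non-empty set $\mathfrak D_{\mathrm b}$ with a left action $(g,x)\mapsto{}^gx$ of a group $G$ and, for each $x\in\mathfrak D_{\mathrm b}$, subsets $\mathfrak D_{\mathrm r}(x),\mathfrak D_{\mathrm i}(x)\subseteq\mathfrak D_{\mathrm b}$ such that for $\star\in\{\mathrm r,\mathrm i\}$: $x\in\mathfrak D_\star(x)$; $y\in\mathfrak D_\star(x)$ implies $\mathfrak D_\star(y)\subseteq\mathfrak D_\star(x)$; ${}^g\mathfrak D_\star(x)=\mathfrak D_\star({}^gx)$. A RIC-functor $\Phi:\mathfrak D\to\mathcal C$ consists of objects $\Phi(x)$ and morphisms $\mathrm{res}_{y,x}:\Phi(x)\to\Phi(y)$ ($y\in\mathfrak D_{\mathrm r}(x)$), $\mathrm{ind}_{x,y}:\Phi(y)\to\Phi(x)$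 ($y\in\mathfrak D_{\mathrm i}(x)$), $\mathrm{con}_{g,x}:\Phi(x)\to\Phi({}^gx)$ such that $\mathrm{res}_{x,x}=\mathrm{ind}_{x,x}=\mathrm{con}_{1,x}=\mathrm{id}$; $\mathrm{res}_{z,y}\mathrm{res}_{y,x}=\mathrm{res}_{z,x}$, $\mathrm{ind}_{x,y}\mathrm{ind}_{y,z}=\mathrm{ind}_{x,z}$, $\mathrm{con}_{g',{}^gx}\mathrm{con}_{g,x}=\mathrm{con}_{g'g,x}$; $\mathrm{con}_{g,y}\mathrm{res}_{y,x}=\mathrm{res}_{{}^gy,{}^gx}\mathrm{con}_{g,x}$ and $\mathrm{con}_{g,x}\mathrm{ind}_{x,y}=\mathrm{ind}_{{}^gx,{}^gy}\mathrm{con}_{g,y}$. $\mathsf{Fct}(\mathfrak D,\mathcal C)$ is the category of these. A subfunctor of $\Phi\in\mathsf{Fct}(\mathfrak D,\mathsf{TAb})$ is a family of subgroups $\Phi'(x)\le\Phi(x)$ stable under res, ind and con. A $G$-subgroup system is a RIC-domain $\mathfrak S$ where $\mathfrak S_{\mathrm b}$ is a set of subgroups of $G$ with the conjugation action and $I\le H$ for $I\in\mathfrak S_\star(H)$; $\mathfrak S'\le\mathfrak S$ means $\mathfrak S'_{\mathrm b}\subseteq\mathfrak S_{\mathrm b}$, $\mathfrak S'_\star(H)\subseteq\mathfrak S_\star(H)$. It is a $G$-Mackey system if for $I\in\mathfrak S_{\mathrm r}(H)$, $J\in\mathfrak S_{\mathrm i}(H)$ the set $I\backslash H/J$ is finite,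 $I\cap J\in\mathfrak S_{\mathrm r}(J)$ and $I\cap J\in\mathfrak S_{\mathrm i}(I)$. A Mackey functor on a Mackey system is a RIC-functor with $\mathrm{con}_{h,H}=\mathrm{id}$ for $h\in H$ and $\mathrm{res}_{I,H}\mathrm{ind}_{H,J}=\sum_{h}\mathrm{ind}_{I,I\cap{}^hJ}\,\mathrm{con}_{h,I^h\cap J}\,\mathrm{res}_{I^h\cap J,J}$ ($h$ over representatives of $I\backslash H/J$). A two-dimensional $G$-subgroup system is a RIC-domain $\mathfrak E$ with $\mathfrak E_{\mathrm b}$ a set of pairs $(H,U)$ ($H$ closed subgroup of $G$, $U$ closed normal subgroup of $H$) with componentwise conjugation and $I\le H$, $V\le U$ for $(I,V)\in\mathfrak E_\star(H,U)$. $\mathfrak E^\flat_{\mathrm b}$ is the set of first components of $\mathfrak E_{\mathrm b}$, $\mathrm{Ext}(\mathfrak E,H)=\{U:(H,U)\in\mathfrak E_{\mathrm b}\}$, $\mathfrak E^\flat_\star(H)$ the set of first components of $\bigcup_U\mathfrak E_\star(H,U)$. $\mathfrak E$ is a $G$-spectrum if $\mathfrak E^\flat$ is a $G$-subgroup system, $(I,V)\in\mathfrak E_{\mathrm r}(H,U)$ implies $V=U$, and $[H:I]<\infty$ for $I\in\mathfrak E^\flat_{\mathrm r}(H)$. A Mackey cover of $\mathfrak E$ is a $G$-Mackey system $\mathfrak M$ with $\mathfrak E^\flat\le\mathfrak M$, $\mathrm{Ext}(\mathfrak E,H)\subseteq\mathfrak M_{\mathrm i}(H)$ for $H\in\mathfrak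 E^\flat_{\mathrm b}$, and $V\in\mathfrak M_{\mathrm i}(U)$ whenever $(I,V)\in\mathfrak E_{\mathrm i}(H,U)$. $C^{\mathfrak E}(H,U)=C(H)$ with the res, ind, con of $C$ on first components. A representation of $\mathfrak E$ is a quotient functor $B^{\mathfrak E}/\Phi$ (values $B(H)/\Phi(H,U)$ with induced maps) with $B\in\mathsf{Fct}(\mathfrak E^\flat,\mathsf{TAb})$ and $\Phi$ a subfunctor of $B^{\mathfrak E}$. -}

module Defs where

open import Algebra.Bundles using (Group; AbelianGroup)
open import Algebra.Morphism.Structures using (module GroupMorphisms)
import Algebra.Morphism.Construct.Composition as Composition
import Algebra.Morphism.Construct.Identity as Identity
import Algebra.Properties.AbelianGroup as AbelianGroupProperties
import Algebra.Properties.CommutativeMonoid.Sum as Sum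
import Algebra.Properties.Group as GroupProperties
open import Data.Fin.Base using (Fin)
open import Data.Product.Base using (Σ; ∃; ∃₂; Σ-syntax; _×_; _,_; proj₁; proj₂; uncurry)
open import Data.Product.Relation.Binary.Pointwise.NonDependent using (×-setoid)
open import Function.Base using (_∘_)
open import Function.Bundles using (Bijection)
open import Level using (_⊔_; suc)
open import Relation.Binary.Bundles using (Setoid)
open import Relation.Binary.Definitions using (_Respects_)
import Relation.Binary.Construct.On as On
open import Relation.Binary.PropositionalEquality.Core using (_≡_)
import Relation.Binary.PropositionalEquality.Properties as ≡
import Relation.Binary.Reasoning.Setoid as SetoidReasoning
open import Relation.Unary using (Pred; _∈_; _⊆_; _≐_; _∩_; ∁; ⋃)
open import Relation.Unary.Polymorphic using (U)

------------------------------------------------------------------------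
-- Topologies on setoids

-- Subsets of a setoid are predicates, and equality of subsets is
-- extensional.  Open sets are required to respect the equality of the
-- setoid.  The empty set is open as the union of the empty family.

record Topology {ℓ} (S : Setoid ℓ ℓ) : Set (suc (suc ℓ)) where
  open Setoid S
  field
    Open      : Pred (Pred Carrier ℓ) (suc ℓ)
    Open-resp : ∀ {P} → Open P → P Respects _≈_
    Open-≐    : ∀ {P Q} → P ≐ Q → Open P → Open Q
    Open-U    : Open U
    Open-∩    : ∀ {P Q} → Open P → Open Q → Open (P ∩ Q)
    Open-⋃    : (I : Set ℓ) (P : I → Pred Carrier ℓ) →
                (∀ i → Open (P i)) → Open (⋃ I P)

  Closed : Pred (Pred Carrier ℓ) (suc ℓ)
  Closed P = Open (∁ P)

Continuous : ∀ {ℓ} {S T : Setoid ℓ ℓ} → Topology S → Topology T →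
             (Setoid.Carrier S → Setoid.Carrier T) → Set (suc ℓ)
Continuous σ τ f = ∀ {V} → V ∈ Topology.Open τ → V ∘ f ∈ Topology.Open σ

module _ {ℓ} {S T : Setoid ℓ ℓ} (σ : Topology S) (τ : Topology T) where
  private
    module S = Setoid S
    module T = Setoid T
    module σ = Topology σ
    module τ = Topology τ

  BoxInside : Pred (S.Carrier × T.Carrier) ℓ → S.Carrier → T.Carrier → Set (suc ℓ)
  BoxInside P x y = ∃₂ λ V W → V ∈ σ.Open × W ∈ τ.Open × x ∈ V × y ∈ W ×
                    (∀ {v w} → v ∈ V → w ∈ W → (v , w) ∈ P)

  productTopology : Topology (×-setoid S T)
  productTopology = record
    { Open      = λ P → P Respects (Setoid._≈_ (×-setoid S T)) ×
                        (∀ x y → (x , y) ∈ P → BoxInside P x y)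
    ; Open-resp = proj₁
    ; Open-≐    = λ { (P⊆Q , Q⊆P) (r , b) →
                    (λ e q → P⊆Q (r e (Q⊆P q))) ,
                    (λ x y q → let (V , W , oV , oW , v , w , s) = b x y (Q⊆P q)
                               in V , W , oV , oW , v , w , λ v w → P⊆Q (s v w)) }
    ; Open-U    = (λ _ u → u) ,
                  (λ x y _ → U , U , σ.Open-U , τ.Open-U , _ , _ , _)
    ; Open-∩    = λ { (r , b) (r′ , b′) →
                    (λ { e (p , q) → r e p , r′ e q }) ,
                    (λ { x y (p , q) →
                      let (V , W , oV , oW , v , w , s)        = b x y p
                          (V′ , W′ , oV′ , oW′ , v′ , w′ , s′) = b′ x y q
                      in V ∩ V′ , W ∩ W′ , σ.Open-∩ oV oV′ , τ.Open-∩ oW oW′ ,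
                         (v , v′) , (w , w′) ,
                         λ { (v , v′) (w , w′) → s v w , s′ v′ w′ } }) }
    ; Open-⋃    = λ I P o →
                    (λ { e (i , p) → i , proj₁ (o i) e p }) ,
                    (λ { x y (i , p) →
                      let (V , W , oV , oW , v , w , s) = proj₂ (o i) x y p
                      in V , W , oV , oW , v , w , λ v w → i , s v w })
    }

subsetoid : ∀ {ℓ} (S : Setoid ℓ ℓ) → Pred (Setoid.Carrier S) ℓ → Setoid ℓ ℓ
subsetoid S P = On.setoid {B = Σ (Setoid.Carrier S) P} S proj₁

subspace : ∀ {ℓ} {S : Setoid ℓ ℓ} → Topology S → (P : Pred (Setoid.Carrier S) ℓ) →
           Topology (subsetoid S P)
subspace {S = S} τ P = record
  { Open      = λ Q → ∃ λ V → V ∈ Open × Q ≐ V ∘ proj₁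
  ; Open-resp = λ { (V , oV , Q⊆V , V⊆Q) e q → V⊆Q (Open-resp oV e (Q⊆V q)) }
  ; Open-≐    = λ { (Q⊆R , R⊆Q) (V , oV , Q⊆V , V⊆Q) →
                  V , oV , (λ r → Q⊆V (R⊆Q r)) , (λ v → Q⊆R (V⊆Q v)) }
  ; Open-U    = U , Open-U , _ , _
  ; Open-∩    = λ { (V , oV , Q⊆V , V⊆Q) (W , oW , R⊆W , W⊆R) →
                  V ∩ W , Open-∩ oV oW ,
                  (λ { (q , r) → Q⊆V q , R⊆W r }) , (λ { (v , w) → V⊆Q v , W⊆R w }) }
  ; Open-⋃    = λ I Q o →
                  ⋃ I (λ i → proj₁ (o i)) ,
                  Open-⋃ I _ (λ i → proj₁ (proj₂ (o i))) ,
                  (λ { (i , q) → i , proj₁ (proj₂ (proj₂ (o i))) q }) ,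
                  (λ { (i , v) → i , proj₂ (proj₂ (proj₂ (o i))) v })
  }
  where open Topology τ

------------------------------------------------------------------------
-- Topological groups

record IsTopologicalGroup {ℓ} (G : Group ℓ ℓ) (τ : Topology (Group.setoid G)) :
                          Set (suc ℓ) where
  open Group G
  field
    ∙-continuous  : Continuous (productTopology τ τ) τ (uncurry _∙_)
    ⁻¹-continuous : Continuous τ τ _⁻¹

record TopologicalGroup ℓ : Set (suc (suc ℓ)) where
  field
    group              : Group ℓ ℓ
    topology           : Topology (Group.setoid group)
    isTopologicalGroup : IsTopologicalGroup group topology

-- The objects of the category TAb.

record TAb ℓ : Set (suc (suc ℓ)) where
  field
    abelianGroup       : AbelianGroup ℓ ℓ
    topology           : Topology (AbelianGroup.setoid abelianGroup)
    isTopologicalGroup : IsTopologicalGroup (AbelianGroup.group abelianGroup) topology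

  open AbelianGroup abelianGroup public
  open Topology topology public
  open IsTopologicalGroup isTopologicalGroup public
  open Sum commutativeMonoid public using (sum)

record Hom {ℓ} (A B : TAb ℓ) : Set (suc ℓ) where
  private
    module A = TAb A
    module B = TAb B
  open GroupMorphisms A.rawGroup B.rawGroup using (IsGroupHomomorphism)
  field
    ⟦_⟧                 : A.Carrier → B.Carrier
    isGroupHomomorphism : IsGroupHomomorphism ⟦_⟧
    continuous          : Continuous A.topology B.topology ⟦_⟧

  open IsGroupHomomorphism isGroupHomomorphism public

open Hom public using (⟦_⟧)

infix 4 _≈ₕ_
infixr 9 _∘ₕ_

_≈ₕ_ : ∀ {ℓ} {A B : TAb ℓ} → Hom A B → Hom A B → Set ℓ
_≈ₕ_ {B = B} f g = ∀ x → TAb._≈_ B (⟦ f ⟧ x) (⟦ g ⟧ x)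

idₕ : ∀ {ℓ} (A : TAb ℓ) → Hom A A
idₕ A = record
  { ⟦_⟧                 = λ x → x
  ; isGroupHomomorphism = Identity.isGroupHomomorphism A.rawGroup A.refl
  ; continuous          = λ o → o
  }
  where module A = TAb A

_∘ₕ_ : ∀ {ℓ} {A B C : TAb ℓ} → Hom B C → Hom A B → Hom A C
_∘ₕ_ {C = C} g f = record
  { ⟦_⟧                 = ⟦ g ⟧ ∘ ⟦ f ⟧
  ; isGroupHomomorphism = Composition.isGroupHomomorphism (TAb.trans C)
                            (Hom.isGroupHomomorphism f) (Hom.isGroupHomomorphism g)
  ; continuous          = λ o → Hom.continuous f (Hom.continuous g o)
  }

------------------------------------------------------------------------
-- Subgroups

record IsSubgroup {c ℓ p} (G : Group c ℓ) (P : Pred (Group.Carrier G) p) :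
                  Set (c ⊔ ℓ ⊔ p) where
  open Group G
  field
    resp : P Respects _≈_
    ε∈   : ε ∈ P
    ∙∈   : ∀ {x y} → x ∈ P → y ∈ P → x ∙ y ∈ P
    ⁻¹∈  : ∀ {x} → x ∈ P → x ⁻¹ ∈ P

------------------------------------------------------------------------
-- Quotients of topological abelian groups

module _ {ℓ} (A : TAb ℓ) {N : Pred (TAb.Carrier A) ℓ}
         (N≤A : IsSubgroup (TAb.group A) N) where
  private
    module A = TAb A
    open A using (Carrier; _≈_; _∙_; _⁻¹; ε; _-_)
    open IsSubgroup N≤A
    open AbelianGroupProperties A.abelianGroup
    open SetoidReasoning A.setoid

    infix 4 _~_
    _~_ : Carrier → Carrier → Set ℓ
    x ~ y = x - y ∈ N

    ≈⇒~ : ∀ {x y} → x ≈ y → x ~ y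
    ≈⇒~ {x} {y} e = resp (A.sym (x≈y⇒x∙y⁻¹≈ε e)) ε∈

    ~-sym : ∀ {x y} → x ~ y → y ~ x
    ~-sym {x} {y} n = resp (⁻¹-anti-homo‿- x y) (⁻¹∈ n)

    ~-trans : ∀ {x y z} → x ~ y → y ~ z → x ~ z
    ~-trans {x} {y} {z} m n = resp eq (∙∈ m n)
      where
      eq : (x - y) ∙ (y - z) ≈ x - z
      eq = begin
        (x - y) ∙ (y - z)       ≈⟨ A.assoc x (y ⁻¹) (y - z) ⟩
        x ∙ (y ⁻¹ ∙ (y - z))    ≈⟨ A.∙-congˡ (\\-leftDividesʳ y (z ⁻¹)) ⟩
        x - z                   ∎

    interchange : ∀ x y u v → (x ∙ u) - (y ∙ v) ≈ (x - y) ∙ (u - v)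
    interchange x y u v = begin
      (x ∙ u) ∙ (y ∙ v) ⁻¹        ≈⟨ A.∙-congˡ (A.sym (⁻¹-∙-comm y v)) ⟩
      (x ∙ u) ∙ (y ⁻¹ ∙ v ⁻¹)     ≈⟨ A.assoc x u _ ⟩
      x ∙ (u ∙ (y ⁻¹ ∙ v ⁻¹))     ≈⟨ A.∙-congˡ (A.sym (A.assoc u _ _)) ⟩
      x ∙ ((u ∙ y ⁻¹) ∙ v ⁻¹)     ≈⟨ A.∙-congˡ (A.∙-congʳ (A.comm u _)) ⟩
      x ∙ ((y ⁻¹ ∙ u) ∙ v ⁻¹)     ≈⟨ A.∙-congˡ (A.assoc _ u _) ⟩
      x ∙ (y ⁻¹ ∙ (u ∙ v ⁻¹))     ≈⟨ A.sym (A.assoc x _ _) ⟩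
      (x ∙ y ⁻¹) ∙ (u ∙ v ⁻¹)     ∎

    ~-∙ : ∀ {x y u v} → x ~ y → u ~ v → x ∙ u ~ y ∙ v
    ~-∙ {x} {y} {u} {v} m n = resp (A.sym (interchange x y u v)) (∙∈ m n)

    ~-⁻¹ : ∀ {x y} → x ~ y → x ⁻¹ ~ y ⁻¹
    ~-⁻¹ {x} {y} n = resp (A.sym (⁻¹-∙-comm x (y ⁻¹))) (⁻¹∈ n)

    group/ : AbelianGroup ℓ ℓ
    group/ = record
      { Carrier        = Carrier
      ; _≈_            = _~_
      ; _∙_            = _∙_
      ; ε              = ε
      ; _⁻¹            = _⁻¹
      ; isAbelianGroup = record
        { isGroup = record
          { isMonoid = record
            { isSemigroup = record
              { isMagma = record
                { isEquivalence = record
                  { refl = ≈⇒~ A.refl ; sym = ~-sym ; trans = ~-trans }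
                ; ∙-cong = ~-∙
                }
              ; assoc = λ x y z → ≈⇒~ (A.assoc x y z)
              }
            ; identity = (λ x → ≈⇒~ (A.identityˡ x)) , (λ x → ≈⇒~ (A.identityʳ x))
            }
          ; inverse = (λ x → ≈⇒~ (A.inverseˡ x)) , (λ x → ≈⇒~ (A.inverseʳ x))
          ; ⁻¹-cong = ~-⁻¹
          }
        ; comm = λ x y → ≈⇒~ (A.comm x y)
        }
      }

    -- V is open iff its preimage under the projection A → A/N, which is
    -- V itself, is open in A.
    topology/ : Topology (AbelianGroup.setoid group/)
    topology/ = record
      { Open      = λ V → V Respects _~_ × V ∈ A.Open
      ; Open-resp = proj₁
      ; Open-≐    = λ { (P⊆Q , Q⊆P) (r , o) →
                      (λ e q → P⊆Q (r e (Q⊆P q))) , A.Open-≐ (P⊆Q , Q⊆P) o }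
      ; Open-U    = (λ _ u → u) , A.Open-U
      ; Open-∩    = λ { (r , o) (r′ , o′) →
                      (λ { e (p , q) → r e p , r′ e q }) , A.Open-∩ o o′ }
      ; Open-⋃    = λ I P o →
                      (λ { e (i , p) → i , proj₁ (o i) e p }) ,
                      A.Open-⋃ I P (λ i → proj₂ (o i))
      }

    translate-open : ∀ {V} → V ∈ A.Open → ∀ z → (λ x → x ∙ z ∈ V) ∈ A.Open
    translate-open {V} oV z =
      A.Open-≐ ((λ { ((x , v) , w) → inside x v w }) , λ {x} v → (x , v) , at x v)
        (A.Open-⋃ (Σ Carrier (λ x → x ∙ z ∈ V)) (λ (x , v) → proj₁ (nbhd x v))
          (λ (x , v) → let (_ , _ , oW , _) = nbhd x v in oW))
      where
      nbhd : ∀ x → x ∙ z ∈ V →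
             BoxInside A.topology A.topology (V ∘ uncurry _∙_) x z
      nbhd x v = proj₂ (A.∙-continuous oV) x z v

      at : ∀ x v → x ∈ proj₁ (nbhd x v)
      at x v = let (_ , _ , _ , _ , x∈ , _) = nbhd x v in x∈

      inside : ∀ x v {w} → w ∈ proj₁ (nbhd x v) → w ∙ z ∈ V
      inside x v w∈ = let (_ , _ , _ , _ , _ , z∈ , s) = nbhd x v in s w∈ z∈

    saturation : Pred Carrier ℓ → Pred Carrier ℓ
    saturation W = ⋃ (Σ Carrier N) (λ (n , _) x → x ∙ n ∈ W)

    saturation-open : ∀ {W} → W ∈ A.Open →
                      saturation W Respects _~_ × saturation W ∈ A.Open
    saturation-open {W} oW = sat ,
      A.Open-⋃ (Σ Carrier N) _ (λ (n , _) → translate-open oW n)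
      where
      sat : saturation W Respects _~_
      sat {x} {y} e ((n , n∈) , w) =
        (y ⁻¹ ∙ (x ∙ n) , resp eq (∙∈ e n∈)) ,
        A.Open-resp oW (A.sym (\\-leftDividesˡ y (x ∙ n))) w
        where
        eq : (x - y) ∙ n ≈ y ⁻¹ ∙ (x ∙ n)
        eq = begin
          (x ∙ y ⁻¹) ∙ n    ≈⟨ A.∙-congʳ (A.comm x _) ⟩
          (y ⁻¹ ∙ x) ∙ n    ≈⟨ A.assoc _ x n ⟩
          y ⁻¹ ∙ (x ∙ n)    ∎

    ⊆-saturation : ∀ {W} → W ∈ A.Open → W ⊆ saturation W
    ⊆-saturation oW w = (ε , ε∈) , A.Open-resp oW (A.sym (A.identityʳ _)) w

  _/ₐ_ : TAb ℓ
  _/ₐ_ = record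
    { abelianGroup       = group/
    ; topology           = topology/
    ; isTopologicalGroup = record
      { ∙-continuous  = λ { {V} (r , oV) →
          (λ (m , n) v → r (~-∙ m n) v) ,
          λ x y v →
            let (W , W′ , oW , oW′ , x∈ , y∈ , s) = proj₂ (A.∙-continuous oV) x y v
            in saturation W , saturation W′ ,
               saturation-open oW , saturation-open oW′ ,
               ⊆-saturation oW x∈ , ⊆-saturation oW′ y∈ ,
               λ { {p} {q} ((m , m∈) , w) ((n , n∈) , w′) →
                   r (resp (A.sym (shift p q m n)) (∙∈ m∈ n∈)) (s w w′) } }
      ; ⁻¹-continuous = λ (r , oV) → (λ n v → r (~-⁻¹ n) v) , A.⁻¹-continuous oV
      }
    }
    where
    shift : ∀ p q m n → ((p ∙ m) ∙ (q ∙ n)) - (p ∙ q) ≈ m ∙ n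
    shift p q m n = begin
      ((p ∙ m) ∙ (q ∙ n)) - (p ∙ q)    ≈⟨ interchange (p ∙ m) p (q ∙ n) q ⟩
      ((p ∙ m) - p) ∙ ((q ∙ n) - q)    ≈⟨ A.∙-cong (xyx⁻¹≈y p m) (xyx⁻¹≈y q n) ⟩
      m ∙ n                            ∎

module _ {ℓ} {A B : TAb ℓ} {N : Pred (TAb.Carrier A) ℓ} {N′ : Pred (TAb.Carrier B) ℓ}
         (N≤A : IsSubgroup (TAb.group A) N) (N′≤B : IsSubgroup (TAb.group B) N′) where
  private
    module A = TAb A
    module B = TAb B

  induced : (f : Hom A B) → (∀ {x} → x ∈ N → ⟦ f ⟧ x ∈ N′) → Hom (A /ₐ N≤A) (B /ₐ N′≤B)
  induced f fN⊆N′ = record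
    { ⟦_⟧                 = ⟦ f ⟧
    ; isGroupHomomorphism = record
      { isMonoidHomomorphism = record
        { isMagmaHomomorphism = record
          { isRelHomomorphism = record { cong = cong }
          ; homo              = λ x y → ≈⇒~ (f.homo x y)
          }
        ; ε-homo              = ≈⇒~ f.ε-homo
        }
      ; ⁻¹-homo              = λ x → ≈⇒~ (f.⁻¹-homo x)
      }
    ; continuous          = λ (r , oV) → (λ n v → r (cong n) v) , f.continuous oV
    }
    where
    module f = Hom f
    open IsSubgroup N′≤B
    open AbelianGroupProperties B.abelianGroup using (x≈y⇒x∙y⁻¹≈ε)

    ≈⇒~ : ∀ {x y} → x B.≈ y → x B.- y ∈ N′
    ≈⇒~ e = resp (B.sym (x≈y⇒x∙y⁻¹≈ε e)) ε∈

    cong : ∀ {x y} → x A.- y ∈ N → ⟦ f ⟧ x B.- ⟦ f ⟧ y ∈ N′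
    cong {x} {y} n = resp (B.trans (f.homo x (y A.⁻¹)) (B.∙-congˡ (f.⁻¹-homo y))) (fN⊆N′ n)

------------------------------------------------------------------------
-- RIC-domains and RIC-functors

record GSet {a} (G : Group a a) x ℓ : Set (a ⊔ suc (x ⊔ ℓ)) where
  infixr 8 _•_
  private module G = Group G
  field
    setoid     : Setoid x ℓ
  open Setoid setoid public
  field
    _•_        : G.Carrier → Carrier → Carrier
    •-cong     : ∀ {g h x y} → g G.≈ h → x ≈ y → g • x ≈ h • y
    •-identity : ∀ x → G.ε • x ≈ x
    •-assoc    : ∀ g h x → (g G.∙ h) • x ≈ g • h • x

-- The set 𝔇_b is an invariant subset Base of an ambient G-set, so that
-- sets of subgroups can be given as predicates on subgroups;
-- y ∈ Res x and y ∈ Ind x stand for y ∈ 𝔇_r(x) and y ∈ 𝔇_i(x).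

record RICData {a} {G : Group a a} {x ℓ} (X : GSet G x ℓ) e : Set (x ⊔ suc e) where
  open GSet X using (Carrier)
  field
    Base    : Pred Carrier e
    Res Ind : Carrier → Pred Carrier e

  Elem : Set (x ⊔ e)
  Elem = Σ Carrier Base

module _ {a} {G : Group a a} {x ℓ} (X : GSet G x ℓ) where
  open GSet X using (Carrier; _≈_; _•_)

  translate : ∀ {e} → Group.Carrier G → Pred Carrier e → Pred Carrier (x ⊔ ℓ ⊔ e)
  translate g P z = ∃ λ y → y ∈ P × z ≈ g • y

  record IsRICRelation {e} (Base : Pred Carrier e) (D : Carrier → Pred Carrier e) :
                       Set (a ⊔ x ⊔ ℓ ⊔ e) where
    field
      ⊆-Base      : ∀ {x y} → y ∈ D x → x ∈ Base × y ∈ Base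
      resp        : ∀ {x x′ y y′} → x ≈ x′ → y ≈ y′ → y ∈ D x → y′ ∈ D x′
      reflexive   : ∀ {x} → x ∈ Base → x ∈ D x
      transitive  : ∀ {x y} → y ∈ D x → D y ⊆ D x
      equivariant : ∀ g {x} → x ∈ Base → translate g (D x) ≐ D (g • x)

record IsRICDomain {a} {G : Group a a} {x ℓ} {X : GSet G x ℓ} {e} (D : RICData X e) :
                   Set (a ⊔ x ⊔ ℓ ⊔ e) where
  open GSet X using (_≈_; _•_)
  open RICData D
  field
    Base-resp     : Base Respects _≈_
    Base-nonempty : ∃ Base
    Base-•        : ∀ g {x} → x ∈ Base → g • x ∈ Base
    isRes         : IsRICRelation X Base Res
    isInd         : IsRICRelation X Base Ind

  module Res = IsRICRelation isRes
  module Ind = IsRICRelation isInd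

record RICDomain {a} {G : Group a a} {x ℓ} (X : GSet G x ℓ) e :
                 Set (a ⊔ suc (x ⊔ ℓ ⊔ e)) where
  field
    ricData     : RICData X e
    isRICDomain : IsRICDomain ricData

  open RICData ricData public
  open IsRICDomain isRICDomain public

-- Since equality in the G-set is not propositional, conjugation is
-- indexed by all y equal to g • x, the morphism con_{g,x} being the case
-- y = g • x.  Transport along an equality x ≈ y is the case g = ε, and
-- every occurrence of an identity map between Φ(x) and Φ(y) for x ≈ y is
-- to be read as this transport.

record RICFunctor {a} {G : Group a a} {x ℓ} {X : GSet G x ℓ} {e}
                  (𝔇 : RICDomain X e) t : Set (a ⊔ x ⊔ ℓ ⊔ e ⊔ suc (suc t)) where
  private module G = Group G
  open GSet X using (_≈_; _•_)
  open RICDomain 𝔇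
  field
    obj : Elem → TAb t
    res : ∀ y x → proj₁ y ∈ Res (proj₁ x) → Hom (obj x) (obj y)
    ind : ∀ x y → proj₁ y ∈ Ind (proj₁ x) → Hom (obj y) (obj x)
    con : ∀ g x y → proj₁ y ≈ g • proj₁ x → Hom (obj x) (obj y)

    con-cong : ∀ {g g′} → g G.≈ g′ → ∀ x y p p′ → con g x y p ≈ₕ con g′ x y p′

    res-id   : ∀ x p → res x x p ≈ₕ idₕ (obj x)
    ind-id   : ∀ x p → ind x x p ≈ₕ idₕ (obj x)
    con-id   : ∀ x p → con G.ε x x p ≈ₕ idₕ (obj x)

    res-res  : ∀ x y z p q r → res z y q ∘ₕ res y x p ≈ₕ res z x r
    ind-ind  : ∀ x y z p q r → ind x y p ∘ₕ ind y z q ≈ₕ ind x z r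
    con-con  : ∀ g g′ x y z p q r → con g′ y z q ∘ₕ con g x y p ≈ₕ con (g′ G.∙ g) x z r

    con-res  : ∀ g x y x′ y′ p p′ q r →
               con g y y′ q ∘ₕ res y x p ≈ₕ res y′ x′ p′ ∘ₕ con g x x′ r
    con-ind  : ∀ g x y x′ y′ p p′ q r →
               con g x x′ r ∘ₕ ind x y p ≈ₕ ind x′ y′ p′ ∘ₕ con g y y′ q

module _ {a} {G : Group a a} {x ℓ} {X : GSet G x ℓ} {e} {𝔇 : RICDomain X e} {t}
         (F : RICFunctor 𝔇 t) where
  open RICDomain 𝔇
  open RICFunctor F

  record IsSubfunctor (Φ : ∀ x → Pred (TAb.Carrier (obj x)) t) :
                      Set (a ⊔ x ⊔ ℓ ⊔ e ⊔ t) where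
    field
      isSubgroup : ∀ x → IsSubgroup (TAb.group (obj x)) (Φ x)
      res-stable : ∀ y x p {c} → c ∈ Φ x → ⟦ res y x p ⟧ c ∈ Φ y
      ind-stable : ∀ x y p {c} → c ∈ Φ y → ⟦ ind x y p ⟧ c ∈ Φ x
      con-stable : ∀ g x y p {c} → c ∈ Φ x → ⟦ con g x y p ⟧ c ∈ Φ y

  quotient : ∀ {Φ} → IsSubfunctor Φ → RICFunctor 𝔇 t
  quotient {Φ} S = record
    { obj      = λ x → obj x /ₐ isSubgroup x
    ; res      = λ y x p → induced (isSubgroup x) (isSubgroup y) (res y x p) (res-stable y x p)
    ; ind      = λ x y p → induced (isSubgroup y) (isSubgroup x) (ind x y p) (ind-stable x y p)
    ; con      = λ g x y p →
                   induced (isSubgroup x) (isSubgroup y) (con g x y p) (con-stable g x y p)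
    ; con-cong = λ e x y p p′ c → ≈⇒~ y (con-cong e x y p p′ c)
    ; res-id   = λ x p c → ≈⇒~ x (res-id x p c)
    ; ind-id   = λ x p c → ≈⇒~ x (ind-id x p c)
    ; con-id   = λ x p c → ≈⇒~ x (con-id x p c)
    ; res-res  = λ x y z p q r c → ≈⇒~ z (res-res x y z p q r c)
    ; ind-ind  = λ x y z p q r c → ≈⇒~ x (ind-ind x y z p q r c)
    ; con-con  = λ g g′ x y z p q r c → ≈⇒~ z (con-con g g′ x y z p q r c)
    ; con-res  = λ g x y x′ y′ p p′ q r c → ≈⇒~ y′ (con-res g x y x′ y′ p p′ q r c)
    ; con-ind  = λ g x y x′ y′ p p′ q r c → ≈⇒~ x′ (con-ind g x y x′ y′ p p′ q r c)
    }
    where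
    open IsSubfunctor S

    ≈⇒~ : ∀ x {c d} → TAb._≈_ (obj x) c d → TAb._-_ (obj x) c d ∈ Φ x
    ≈⇒~ x e = resp (sym (x≈y⇒x∙y⁻¹≈ε e)) ε∈
      where
      open TAb (obj x) using (sym)
      open IsSubgroup (isSubgroup x)
      open AbelianGroupProperties (TAb.abelianGroup (obj x)) using (x≈y⇒x∙y⁻¹≈ε)

------------------------------------------------------------------------
-- Subgroups with the conjugation action

record Subgroup {a} (G : Group a a) : Set (suc a) where
  field
    member     : Pred (Group.Carrier G) a
    isSubgroup : IsSubgroup G member

  open IsSubgroup isSubgroup public

module _ {a} {G : Group a a} where
  open Group G
  open GroupProperties G
  open SetoidReasoning setoid

  infix 4 _∈ₛ_ _≤ₛ_ _≐ₛ_
  infixr 7 _∩ₛ_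

  _∈ₛ_ : Carrier → Subgroup G → Set a
  g ∈ₛ H = g ∈ Subgroup.member H

  _≤ₛ_ _≐ₛ_ : Subgroup G → Subgroup G → Set a
  I ≤ₛ H = Subgroup.member I ⊆ Subgroup.member H
  I ≐ₛ H = Subgroup.member I ≐ Subgroup.member H

  _∩ₛ_ : Subgroup G → Subgroup G → Subgroup G
  I ∩ₛ J = record
    { member     = I.member ∩ J.member
    ; isSubgroup = record
      { resp = λ e (p , q) → I.resp e p , J.resp e q
      ; ε∈   = I.ε∈ , J.ε∈
      ; ∙∈   = λ (p , q) (p′ , q′) → I.∙∈ p p′ , J.∙∈ q q′
      ; ⁻¹∈  = λ (p , q) → I.⁻¹∈ p , J.⁻¹∈ q
      }
    }
    where
    module I = Subgroup I
    module J = Subgroup J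

  conj : Carrier → Carrier → Carrier
  conj g h = g ∙ h ∙ g ⁻¹

  conj-cong : ∀ {g g′ h h′} → g ≈ g′ → h ≈ h′ → conj g h ≈ conj g′ h′
  conj-cong p q = ∙-cong (∙-cong p q) (⁻¹-cong p)

  conj-homo : ∀ g h k → conj g (h ∙ k) ≈ conj g h ∙ conj g k
  conj-homo g h k = begin
    g ∙ (h ∙ k) ∙ g ⁻¹                   ≈⟨ ∙-congʳ (sym (assoc g h k)) ⟩
    (g ∙ h) ∙ k ∙ g ⁻¹                   ≈⟨ assoc (g ∙ h) k (g ⁻¹) ⟩
    (g ∙ h) ∙ (k ∙ g ⁻¹)                 ≈⟨ ∙-congˡ (sym (\\-leftDividesʳ g (k ∙ g ⁻¹))) ⟩
    (g ∙ h) ∙ (g ⁻¹ ∙ (g ∙ (k ∙ g ⁻¹)))  ≈⟨ sym (assoc (g ∙ h) (g ⁻¹) _) ⟩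
    conj g h ∙ (g ∙ (k ∙ g ⁻¹))          ≈⟨ ∙-congˡ (sym (assoc g k (g ⁻¹))) ⟩
    conj g h ∙ conj g k                  ∎

  conj-ε : ∀ g → conj g ε ≈ ε
  conj-ε g = trans (∙-congʳ (identityʳ g)) (inverseʳ g)

  conj-⁻¹ : ∀ g h → conj g (h ⁻¹) ≈ conj g h ⁻¹
  conj-⁻¹ g h = inverseˡ-unique (conj g (h ⁻¹)) (conj g h) (begin
    conj g (h ⁻¹) ∙ conj g h    ≈⟨ sym (conj-homo g (h ⁻¹) h) ⟩
    conj g (h ⁻¹ ∙ h)           ≈⟨ conj-cong refl (inverseˡ h) ⟩
    conj g ε                    ≈⟨ conj-ε g ⟩
    ε                           ∎)

  conj-identity : ∀ h → conj ε h ≈ h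
  conj-identity h = begin
    ε ∙ h ∙ ε ⁻¹    ≈⟨ ∙-cong (identityˡ h) ε⁻¹≈ε ⟩
    h ∙ ε           ≈⟨ identityʳ h ⟩
    h               ∎

  conj-assoc : ∀ g g′ h → conj (g ∙ g′) h ≈ conj g (conj g′ h)
  conj-assoc g g′ h = begin
    g ∙ g′ ∙ h ∙ (g ∙ g′) ⁻¹         ≈⟨ ∙-cong (assoc g g′ h) (⁻¹-anti-homo-∙ g g′) ⟩
    g ∙ (g′ ∙ h) ∙ (g′ ⁻¹ ∙ g ⁻¹)    ≈⟨ sym (assoc _ (g′ ⁻¹) (g ⁻¹)) ⟩
    g ∙ (g′ ∙ h) ∙ g′ ⁻¹ ∙ g ⁻¹      ≈⟨ ∙-congʳ (assoc g (g′ ∙ h) (g′ ⁻¹)) ⟩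
    conj g (conj g′ h)               ∎

  conjₛ : Carrier → Subgroup G → Subgroup G
  conjₛ g H = record
    { member     = λ x → ∃ λ h → h ∈ₛ H × x ≈ conj g h
    ; isSubgroup = record
      { resp = λ e (h , h∈ , x≈) → h , h∈ , trans (sym e) x≈
      ; ε∈   = ε , H.ε∈ , sym (conj-ε g)
      ; ∙∈   = λ (h , h∈ , x≈) (k , k∈ , y≈) →
                 h ∙ k , H.∙∈ h∈ k∈ , trans (∙-cong x≈ y≈) (sym (conj-homo g h k))
      ; ⁻¹∈  = λ (h , h∈ , x≈) →
                 h ⁻¹ , H.⁻¹∈ h∈ , trans (⁻¹-cong x≈) (sym (conj-⁻¹ g h))
      }
    }
    where module H = Subgroup H

  conjₛ-≤ : ∀ {g g′ H H′} → g ≈ g′ → H ≤ₛ H′ → conjₛ g H ≤ₛ conjₛ g′ H′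
  conjₛ-≤ e s (h , h∈ , x≈) = h , s h∈ , trans x≈ (conj-cong e refl)

  conjₛ-∈ : ∀ {h} H → h ∈ₛ H → conjₛ h H ≐ₛ H
  conjₛ-∈ {h} H h∈ =
    (λ (k , k∈ , x≈) → H.resp (sym x≈) (H.∙∈ (H.∙∈ h∈ k∈) (H.⁻¹∈ h∈))) ,
    (λ {x} x∈ → conj (h ⁻¹) x , H.∙∈ (H.∙∈ (H.⁻¹∈ h∈) x∈) (H.⁻¹∈ (H.⁻¹∈ h∈)) , (begin
      x                         ≈⟨ sym (conj-identity x) ⟩
      conj ε x                  ≈⟨ conj-cong (sym (inverseʳ h)) refl ⟩
      conj (h ∙ h ⁻¹) x         ≈⟨ conj-assoc h (h ⁻¹) x ⟩
      conj h (conj (h ⁻¹) x)    ∎))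
    where module H = Subgroup H

  conjₛ-∩ : ∀ h I J → I ∩ₛ conjₛ h J ≐ₛ conjₛ h (conjₛ (h ⁻¹) I ∩ₛ J)
  conjₛ-∩ h I J =
    (λ { {x} (x∈ , k , k∈ , x≈) → k , ((x , x∈ , back k x x≈) , k∈) , x≈ }) ,
    (λ { {x} (k , ((i , i∈ , k≈) , k∈) , x≈) →
       Subgroup.resp I (sym (trans x≈ (trans (conj-cong refl k≈) (cancel i)))) i∈ ,
       k , k∈ , x≈ })
    where
    cancel : ∀ i → conj h (conj (h ⁻¹) i) ≈ i
    cancel i = trans (sym (conj-assoc h (h ⁻¹) i))
                 (trans (conj-cong (inverseʳ h) refl) (conj-identity i))

    back : ∀ k x → x ≈ conj h k → k ≈ conj (h ⁻¹) x
    back k x x≈ = sym (begin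
      conj (h ⁻¹) x             ≈⟨ conj-cong refl x≈ ⟩
      conj (h ⁻¹) (conj h k)    ≈⟨ sym (conj-assoc (h ⁻¹) h k) ⟩
      conj (h ⁻¹ ∙ h) k         ≈⟨ conj-cong (inverseˡ h) refl ⟩
      conj ε k                  ≈⟨ conj-identity k ⟩
      k                         ∎)

module _ {a} (G : Group a a) where
  open Group G

  subgroups : GSet G (suc a) a
  subgroups = record
    { setoid     = record
      { Carrier       = Subgroup G
      ; _≈_           = _≐ₛ_
      ; isEquivalence = record
        { refl  = (λ p → p) , (λ p → p)
        ; sym   = λ (p , q) → q , p
        ; trans = λ (p , q) (p′ , q′) → (λ x → p′ (p x)) , (λ x → q (q′ x))
        }
      }
    ; _•_        = conjₛ
    ; •-cong     = λ {_} {_} {H} {H′} e (p , q) →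
                     conjₛ-≤ {H = H} {H′} e p , conjₛ-≤ {H = H′} {H} (sym e) q
    ; •-identity = λ H →
                     (λ (h , h∈ , x≈) →
                        Subgroup.resp H (sym (trans x≈ (conj-identity {G = G} h))) h∈) ,
                     (λ {x} x∈ → x , x∈ , sym (conj-identity {G = G} x))
    ; •-assoc    = λ g g′ H →
                     (λ (h , h∈ , x≈) →
                        conj {G = G} g′ h , (h , h∈ , refl) ,
                        trans x≈ (conj-assoc {G = G} g g′ h)) ,
                     (λ (k , (h , h∈ , k≈) , x≈) →
                        h , h∈ ,
                        trans x≈ (trans (conj-cong {G = G} refl k≈)
                                        (sym (conj-assoc {G = G} g g′ h))))
    }

  subgroupPairs : GSet G (suc a) a
  subgroupPairs = record
    { setoid     = ×-setoid S.setoid S.setoid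
    ; _•_        = λ g (H , V) → g S.• H , g S.• V
    ; •-cong     = λ {g} {g′} {x} {y} e (p , q) →
                     S.•-cong {x = proj₁ x} {proj₁ y} e p ,
                     S.•-cong {x = proj₂ x} {proj₂ y} e q
    ; •-identity = λ (H , V) → S.•-identity H , S.•-identity V
    ; •-assoc    = λ g h (H , V) → S.•-assoc g h H , S.•-assoc g h V
    }
    where module S = GSet subgroups

------------------------------------------------------------------------
-- Cosets

Finite : ∀ {a ℓ} → Setoid a ℓ → Set (a ⊔ ℓ)
Finite S = ∃ λ n → Bijection (≡.setoid (Fin n)) S

module _ {a} {G : Group a a} where
  open Group G
  open GroupProperties G
  open SetoidReasoning setoid

  -- The set I\H/J; a system of representatives is a bijection from some
  -- Fin n onto this setoid.
  doubleCosets : Subgroup G → Subgroup G → Subgroup G → Setoid a a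
  doubleCosets I H J = record
    { Carrier       = Σ Carrier (_∈ₛ H)
    ; _≈_           = λ (h , _) (h′ , _) →
                        ∃₂ λ i j → i ∈ₛ I × j ∈ₛ J × h′ ≈ i ∙ h ∙ j
    ; isEquivalence = record
      { refl  = λ {(h , _)} →
                  ε , ε , I.ε∈ , J.ε∈ , sym (trans (identityʳ _) (identityˡ h))
      ; sym   = λ {(h , _)} {(h′ , _)} (i , j , i∈ , j∈ , e) →
                  i ⁻¹ , j ⁻¹ , I.⁻¹∈ i∈ , J.⁻¹∈ j∈ , (begin
                    h                              ≈⟨ sym (\\-leftDividesʳ i h) ⟩
                    i ⁻¹ ∙ (i ∙ h)                 ≈⟨ ∙-congˡ (sym (//-rightDividesʳ j (i ∙ h))) ⟩
                    i ⁻¹ ∙ (i ∙ h ∙ j ∙ j ⁻¹)      ≈⟨ sym (assoc _ _ _) ⟩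
                    i ⁻¹ ∙ (i ∙ h ∙ j) ∙ j ⁻¹      ≈⟨ ∙-congʳ (∙-congˡ (sym e)) ⟩
                    i ⁻¹ ∙ h′ ∙ j ⁻¹               ∎)
      ; trans = λ {(h , _)} {(h′ , _)} {(h″ , _)}
                  (i , j , i∈ , j∈ , e) (i′ , j′ , i′∈ , j′∈ , e′) →
                  i′ ∙ i , j ∙ j′ , I.∙∈ i′∈ i∈ , J.∙∈ j∈ j′∈ , (begin
                    h″                             ≈⟨ e′ ⟩
                    i′ ∙ h′ ∙ j′                   ≈⟨ ∙-congʳ (∙-congˡ e) ⟩
                    i′ ∙ (i ∙ h ∙ j) ∙ j′          ≈⟨ ∙-congʳ (sym (assoc i′ (i ∙ h) j)) ⟩
                    i′ ∙ (i ∙ h) ∙ j ∙ j′          ≈⟨ assoc _ j j′ ⟩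
                    i′ ∙ (i ∙ h) ∙ (j ∙ j′)        ≈⟨ ∙-congʳ (sym (assoc i′ i h)) ⟩
                    i′ ∙ i ∙ h ∙ (j ∙ j′)          ∎)
      }
    }
    where
    module I = Subgroup I
    module J = Subgroup J

  cosets : Subgroup G → Subgroup G → Setoid a a
  cosets H I = record
    { Carrier       = Σ Carrier (_∈ₛ H)
    ; _≈_           = λ (h , _) (h′ , _) → ∃ λ i → i ∈ₛ I × h′ ≈ h ∙ i
    ; isEquivalence = record
      { refl  = λ {(h , _)} → ε , I.ε∈ , sym (identityʳ h)
      ; sym   = λ {(h , _)} (i , i∈ , e) →
                  i ⁻¹ , I.⁻¹∈ i∈ ,
                  trans (sym (//-rightDividesʳ i h)) (∙-congʳ (sym e))
      ; trans = λ {(h , _)} (i , i∈ , e) (i′ , i′∈ , e′) →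
                  i ∙ i′ , I.∙∈ i∈ i′∈ ,
                  trans e′ (trans (∙-congʳ e) (assoc h i i′))
      }
    }
    where module I = Subgroup I

  FiniteIndex : Subgroup G → Subgroup G → Set a
  FiniteIndex H I = Finite (cosets H I)

------------------------------------------------------------------------
-- Subgroup systems and Mackey functors

record IsSubgroupSystem {a} {G : Group a a} {e} (S : RICData (subgroups G) e) :
                        Set (suc a ⊔ e) where
  open RICData S
  field
    isRICDomain : IsRICDomain S
    Res-≤       : ∀ {H I} → I ∈ Res H → I ≤ₛ H
    Ind-≤       : ∀ {H I} → I ∈ Ind H → I ≤ₛ H

  ricDomain : RICDomain (subgroups G) e
  ricDomain = record { ricData = S ; isRICDomain = isRICDomain }

infix 4 _⊑_

record _⊑_ {a} {G : Group a a} {e e′} (S : RICData (subgroups G) e)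
           (S′ : RICData (subgroups G) e′) : Set (suc a ⊔ e ⊔ e′) where
  private
    module S = RICData S
    module S′ = RICData S′
  field
    Base-⊆ : S.Base ⊆ S′.Base
    Res-⊆  : ∀ {H} → S.Res H ⊆ S′.Res H
    Ind-⊆  : ∀ {H} → S.Ind H ⊆ S′.Ind H

restrict : ∀ {a} {G : Group a a} {e e′} {𝔖 : RICDomain (subgroups G) e}
           {𝔖′ : RICDomain (subgroups G) e′} →
           RICDomain.ricData 𝔖 ⊑ RICDomain.ricData 𝔖′ →
           ∀ {t} → RICFunctor 𝔖′ t → RICFunctor 𝔖 t
restrict {𝔖 = 𝔖} {𝔖′} 𝔖⊑𝔖′ F = record
  { obj      = λ x → F.obj (up x)
  ; res      = λ y x p → F.res (up y) (up x) (Res-⊆ p)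
  ; ind      = λ x y p → F.ind (up x) (up y) (Ind-⊆ p)
  ; con      = λ g x y p → F.con g (up x) (up y) p
  ; con-cong = λ e x y p p′ → F.con-cong e (up x) (up y) p p′
  ; res-id   = λ x p → F.res-id (up x) _
  ; ind-id   = λ x p → F.ind-id (up x) _
  ; con-id   = λ x p → F.con-id (up x) p
  ; res-res  = λ x y z p q r → F.res-res (up x) (up y) (up z) _ _ _
  ; ind-ind  = λ x y z p q r → F.ind-ind (up x) (up y) (up z) _ _ _
  ; con-con  = λ g g′ x y z p q r → F.con-con g g′ (up x) (up y) (up z) p q r
  ; con-res  = λ g x y x′ y′ p p′ q r →
                 F.con-res g (up x) (up y) (up x′) (up y′) _ _ q r
  ; con-ind  = λ g x y x′ y′ p p′ q r →
                 F.con-ind g (up x) (up y) (up x′) (up y′) _ _ q r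
  }
  where
  module F = RICFunctor F
  open _⊑_ 𝔖⊑𝔖′

  up : RICDomain.Elem 𝔖 → RICDomain.Elem 𝔖′
  up (H , b) = H , Base-⊆ b

record MackeySystem {a} (G : Group a a) e : Set (suc (suc a ⊔ e)) where
  field
    ricData          : RICData (subgroups G) e
    isSubgroupSystem : IsSubgroupSystem ricData
  open RICData ricData
  field
    finite : ∀ {H I J} → I ∈ Res H → J ∈ Ind H → Finite (doubleCosets I H J)
    ∩-Res  : ∀ {H I J} → I ∈ Res H → J ∈ Ind H → I ∩ₛ J ∈ Res J
    ∩-Ind  : ∀ {H I J} → I ∈ Res H → J ∈ Ind H → I ∩ₛ J ∈ Ind I

  open IsSubgroupSystem isSubgroupSystem public
  open RICDomain ricDomain public hiding (ricData; isRICDomain)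

module MackeyFormula {a} {G : Group a a} {e} (𝔐 : MackeySystem G e) {t}
                     (C : RICFunctor (MackeySystem.ricDomain 𝔐) t) where
  open Group G
  open MackeySystem 𝔐
  open RICFunctor C
  private module S = GSet (subgroups G)

  module _ (H I J : Elem) (p : proj₁ I ∈ Res (proj₁ H)) (q : proj₁ J ∈ Ind (proj₁ H)) where

    module _ (h : Carrier) (h∈H : h ∈ₛ proj₁ H) where
      private
        conj-Ind : conjₛ h (proj₁ J) ∈ Ind (proj₁ H)
        conj-Ind = Ind.resp {y = conjₛ h (proj₁ J)} (conjₛ-∈ (proj₁ H) h∈H)
          (S.refl {conjₛ h (proj₁ J)})
          (proj₁ (Ind.equivariant h (proj₂ H)) (proj₁ J , q , S.refl {conjₛ h (proj₁ J)}))

        conj-Res : conjₛ (h ⁻¹) (proj₁ I) ∈ Res (proj₁ H)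
        conj-Res = Res.resp {y = conjₛ (h ⁻¹) (proj₁ I)}
          (conjₛ-∈ (proj₁ H) (Subgroup.⁻¹∈ (proj₁ H) h∈H))
          (S.refl {conjₛ (h ⁻¹) (proj₁ I)})
          (proj₁ (Res.equivariant (h ⁻¹) (proj₂ H))
            (proj₁ I , p , S.refl {conjₛ (h ⁻¹) (proj₁ I)}))

        i : proj₁ I ∩ₛ conjₛ h (proj₁ J) ∈ Ind (proj₁ I)
        i = ∩-Ind p conj-Ind

        r : conjₛ (h ⁻¹) (proj₁ I) ∩ₛ proj₁ J ∈ Res (proj₁ J)
        r = ∩-Res conj-Res q

        I∩ʰJ Iʰ∩J : Elem
        I∩ʰJ = proj₁ I ∩ₛ conjₛ h (proj₁ J) , proj₂ (Ind.⊆-Base i)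
        Iʰ∩J = conjₛ (h ⁻¹) (proj₁ I) ∩ₛ proj₁ J , proj₂ (Res.⊆-Base r)

      summand : Hom (obj J) (obj I)
      summand = ind I I∩ʰJ i
             ∘ₕ con h Iʰ∩J I∩ʰJ (conjₛ-∩ h (proj₁ I) (proj₁ J))
             ∘ₕ res Iʰ∩J J r

    HoldsAt : Set (a ⊔ t)
    HoldsAt = ∀ n (h : Bijection (≡.setoid (Fin n))
                         (doubleCosets (proj₁ I) (proj₁ H) (proj₁ J))) c →
              TAb._≈_ (obj I)
                (⟦ res I H p ∘ₕ ind H J q ⟧ c)
                (TAb.sum (obj I)
                  (λ k → ⟦ uncurry summand (Bijection.to h k) ⟧ c))

record MackeyFunctor {a} {G : Group a a} {e} (𝔐 : MackeySystem G e) t :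
                     Set (suc a ⊔ e ⊔ suc (suc t)) where
  open MackeySystem 𝔐
  field
    functor : RICFunctor ricDomain t
  open RICFunctor functor public
  field
    con-inner     : ∀ H {h} → h ∈ₛ proj₁ H → ∀ p → con h H H p ≈ₕ idₕ (obj H)
    mackeyFormula : ∀ H I J p q → MackeyFormula.HoldsAt 𝔐 functor H I J p q

------------------------------------------------------------------------
-- Spectra and Mackey covers

module _ {a} (G : TopologicalGroup a) where
  open TopologicalGroup G
  open Group group using (Carrier)

  IsClosed : Subgroup group → Set (suc a)
  IsClosed H = Subgroup.member H ∈ Topology.Closed topology

  record IsClosedNormalSubgroup (V H : Subgroup group) : Set (suc a) where
    field
      ≤      : V ≤ₛ H
      closed : (λ h → proj₁ h ∈ₛ V) ∈ Topology.Closed (subspace topology (Subgroup.member H))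
      normal : ∀ {h v} → h ∈ₛ H → v ∈ₛ V → conj {G = group} h v ∈ₛ V

  record IsTwoDimensionalSystem {e} (E : RICData (subgroupPairs group) e) :
                                Set (suc a ⊔ e) where
    open RICData E
    field
      isRICDomain : IsRICDomain E
      Base-closed : ∀ {H V} → (H , V) ∈ Base → IsClosed H
      Base-normal : ∀ {H V} → (H , V) ∈ Base → IsClosedNormalSubgroup V H
      Res-≤       : ∀ {H V I W} → (I , W) ∈ Res (H , V) → I ≤ₛ H × W ≤ₛ V
      Ind-≤       : ∀ {H V I W} → (I , W) ∈ Ind (H , V) → I ≤ₛ H × W ≤ₛ V

module _ {a} {G : Group a a} {e} (E : RICData (subgroupPairs G) e) where
  open RICData E

  infix 10 _♭

  _♭ : RICData (subgroups G) (suc a ⊔ e)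
  _♭ = record
    { Base = λ H → ∃ λ V → (H , V) ∈ Base
    ; Res  = λ H I → ∃₂ λ V W → (I , W) ∈ Res (H , V)
    ; Ind  = λ H I → ∃₂ λ V W → (I , W) ∈ Ind (H , V)
    }

  Ext : Subgroup G → Pred (Subgroup G) e
  Ext H V = (H , V) ∈ Base

record Spectrum {a} (G : TopologicalGroup a) e : Set (suc (suc a ⊔ e)) where
  open TopologicalGroup G using (group)
  field
    ricData                : RICData (subgroupPairs group) e
    isTwoDimensionalSystem : IsTwoDimensionalSystem G ricData
    ♭-isSubgroupSystem     : IsSubgroupSystem (ricData ♭)
  open RICData ricData
  field
    Res-≐      : ∀ {H V I W} → (I , W) ∈ Res (H , V) → W ≐ₛ V
    Res-finite : ∀ {H I} → I ∈ RICData.Res (ricData ♭) H → FiniteIndex H I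

  open IsTwoDimensionalSystem isTwoDimensionalSystem public

  ricDomain : RICDomain (subgroupPairs group) e
  ricDomain = record { ricData = ricData ; isRICDomain = isRICDomain }

  open RICDomain ricDomain public hiding (ricData; isRICDomain)

  ♭-ricDomain : RICDomain (subgroups group) (suc a ⊔ e)
  ♭-ricDomain = IsSubgroupSystem.ricDomain ♭-isSubgroupSystem

record MackeyCover {a} {G : TopologicalGroup a} {e} (𝔈 : Spectrum G e) m :
                   Set (suc (suc a ⊔ e ⊔ m)) where
  open TopologicalGroup G using (group)
  private module 𝔈 = Spectrum 𝔈
  field
    system : MackeySystem group m
  private module 𝔐 = MackeySystem system
  field
    ♭-⊑     : 𝔈.ricData ♭ ⊑ 𝔐.ricData
    Ext-⊆   : ∀ {H} → H ∈ RICData.Base (𝔈.ricData ♭) → Ext 𝔈.ricData H ⊆ 𝔐.Ind H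
    Ind-snd : ∀ {H V I W} → (I , W) ∈ 𝔈.Ind (H , V) → W ∈ 𝔐.Ind V

------------------------------------------------------------------------
-- Representations

module _ {a} {G : TopologicalGroup a} {e} (𝔈 : Spectrum G e) where
  open TopologicalGroup G using (group)
  private module 𝔈 = Spectrum 𝔈

  -- The functor B^𝔈.
  inflate : ∀ {t} → RICFunctor 𝔈.♭-ricDomain t → RICFunctor 𝔈.ricDomain t
  inflate B = record
    { obj      = λ x → B.obj (fst x)
    ; res      = λ y x p → B.res (fst y) (fst x) (_ , _ , p)
    ; ind      = λ x y p → B.ind (fst x) (fst y) (_ , _ , p)
    ; con      = λ g x y p → B.con g (fst x) (fst y) (proj₁ p)
    ; con-cong = λ e x y p p′ → B.con-cong e (fst x) (fst y) (proj₁ p) (proj₁ p′)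
    ; res-id   = λ x p → B.res-id (fst x) _
    ; ind-id   = λ x p → B.ind-id (fst x) _
    ; con-id   = λ x p → B.con-id (fst x) _
    ; res-res  = λ x y z p q r → B.res-res (fst x) (fst y) (fst z) _ _ _
    ; ind-ind  = λ x y z p q r → B.ind-ind (fst x) (fst y) (fst z) _ _ _
    ; con-con  = λ g g′ x y z p q r → B.con-con g g′ (fst x) (fst y) (fst z) _ _ _
    ; con-res  = λ g x y x′ y′ p p′ q r →
                   B.con-res g (fst x) (fst y) (fst x′) (fst y′) _ _ _ _
    ; con-ind  = λ g x y x′ y′ p p′ q r →
                   B.con-ind g (fst x) (fst y) (fst x′) (fst y′) _ _ _ _
    }
    where
    module B = RICFunctor B

    fst : 𝔈.Elem → RICDomain.Elem 𝔈.♭-ricDomain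
    fst ((H , V) , b) = H , V , b

  IsRepresentation : ∀ {t} → RICFunctor 𝔈.ricDomain t → Set (suc a ⊔ e ⊔ suc (suc t))
  IsRepresentation {t} F =
    Σ[ B ∈ RICFunctor 𝔈.♭-ricDomain t ]
    Σ[ Φ ∈ (∀ x → Pred (TAb.Carrier (RICFunctor.obj (inflate B) x)) t) ]
    Σ[ S ∈ IsSubfunctor (inflate B) Φ ]
    F ≡ quotient (inflate B) S

module _ {a} {G : TopologicalGroup a} {e} {𝔈 : Spectrum G e} {m} (𝔐 : MackeyCover 𝔈 m)
         {t} (C : MackeyFunctor (MackeyCover.system 𝔐) t) where
  private
    module 𝔈 = Spectrum 𝔈
    module 𝔐 = MackeySystem (MackeyCover.system 𝔐)
    module C = MackeyFunctor C
  open MackeyCover 𝔐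

  -- The functor C^𝔈.
  inflation : RICFunctor 𝔈.ricDomain t
  inflation = inflate 𝔈 (restrict {𝔖 = 𝔈.♭-ricDomain} {𝔐.ricDomain} ♭-⊑ C.functor)

  -- (H , V) ↦ ind_{H,V} C(V)
  inductionImage : ∀ x → Pred (TAb.Carrier (RICFunctor.obj inflation x)) t
  inductionImage ((H , V) , b) c =
    ∃ λ d → TAb._≈_ (C.obj H′) c (⟦ C.ind H′ V′ V∈Ind ⟧ d)
    where
    V∈Ind : V ∈ 𝔐.Ind H
    V∈Ind = Ext-⊆ (V , b) b

    H′ V′ : 𝔐.Elem
    H′ = H , _⊑_.Base-⊆ ♭-⊑ (V , b)
    V′ = V , proj₂ (𝔐.Ind.⊆-Base V∈Ind)

{-# OPTIONS --safe #-}
module Submission where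

open import Defs
open import Algebra.Bundles using (Group)
open import Data.Fin.Base using (Fin; zero; suc)
open import Data.Nat.Base using (zero; suc)
open import Data.Product.Base using (Σ-syntax; _,_; proj₁; proj₂)
open import Function.Base using (_∘_)
open import Function.Bundles using (Bijection)
open import Relation.Binary.PropositionalEquality.Core using (_≡_; refl)
import Relation.Binary.Reasoning.Setoid as SetoidReasoning
open import Relation.Unary using (Pred; _∈_)

-- Stability under induction is transitivity of induction, and stability
-- under conjugation is its compatibility with induction.  For restriction
-- from H to I ⊇ U, normality of U in H gives I ∩ ʰU = U for all h ∈ H, so
-- every term of the Mackey formula for res_{I,H} ind_{H,U} is induced
-- from U.

sum-∈ : ∀ {ℓ} (A : TAb ℓ) {N : Pred (TAb.Carrier A) ℓ} → IsSubgroup (TAb.group A) N →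
        ∀ n (f : Fin n → TAb.Carrier A) → (∀ k → f k ∈ N) → TAb.sum A f ∈ N
sum-∈ A N≤A zero    f f∈ = IsSubgroup.ε∈ N≤A
sum-∈ A N≤A (suc n) f f∈ =
  IsSubgroup.∙∈ N≤A (f∈ zero) (sum-∈ A N≤A n (f ∘ suc) (λ k → f∈ (suc k)))

image-isSubgroup : ∀ {ℓ} {A B : TAb ℓ} (f : Hom A B) →
                   IsSubgroup (TAb.group B) (λ b → Σ[ a ∈ TAb.Carrier A ] TAb._≈_ B b (⟦ f ⟧ a))
image-isSubgroup {A = A} {B} f = record
  { resp = λ e (a , x≈) → a , B.trans (B.sym e) x≈
  ; ε∈   = A.ε , B.sym f.ε-homo
  ; ∙∈   = λ (a , x≈) (b , y≈) →
             a A.∙ b , B.trans (B.∙-cong x≈ y≈) (B.sym (f.homo a b))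
  ; ⁻¹∈  = λ (a , x≈) → a A.⁻¹ , B.trans (B.⁻¹-cong x≈) (B.sym (f.⁻¹-homo a))
  }
  where
  module A = TAb A
  module B = TAb B
  module f = Hom f

module _ {a} {G : TopologicalGroup a} where
  open TopologicalGroup G using (group)
  open Group group

  conjₛ-normal : ∀ {V H h} → IsClosedNormalSubgroup G V H → h ∈ₛ H →
                 _≐ₛ_ {G = group} (conjₛ h V) V
  conjₛ-normal {V} {H} {h} V⊴H h∈ =
    (λ (v , v∈ , x≈) → V.resp (sym x≈) (normal h∈ v∈)) ,
    (λ {x} x∈ → conj {G = group} (h ⁻¹) x , normal (Subgroup.⁻¹∈ H h∈) x∈ ,
      sym (trans (sym (conj-assoc {G = group} h (h ⁻¹) x))
            (trans (conj-cong {G = group} (inverseʳ h) (Group.refl group))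
                   (conj-identity {G = group} x))))
    where
    open IsClosedNormalSubgroup V⊴H
    module V = Subgroup V

module _ {a} {G : Group a a} {e} {𝔖 : RICDomain (subgroups G) e} {t} (F : RICFunctor 𝔖 t) where
  open RICDomain 𝔖
  open RICFunctor F
  private module S = GSet (subgroups G)

  -- The con is the transport along K ≐ W.
  ind-≐ : ∀ I K W p q (K≐W : W .proj₁ ≐ₛ K .proj₁) →
          ind I K p ≈ₕ ind I W q ∘ₕ con (Group.ε G) K W
            (S.trans {proj₁ W} {proj₁ K} {conjₛ (Group.ε G) (proj₁ K)} K≐W
              (S.sym {conjₛ (Group.ε G) (proj₁ K)} {proj₁ K} (S.•-identity (proj₁ K))))
  ind-≐ I K W p q K≐W c = trans (sym (con-id I I≐ (⟦ ind I K p ⟧ c)))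
                            (con-ind (Group.ε G) I K I W p q _ I≐ c)
    where
    open TAb (obj I) using (trans; sym)
    I≐ : proj₁ I ≐ₛ conjₛ (Group.ε G) (proj₁ I)
    I≐ = S.sym {conjₛ (Group.ε G) (proj₁ I)} {proj₁ I} (S.•-identity (proj₁ I))

module _ {a} {G : TopologicalGroup a} {e} {𝔈 : Spectrum G e} {m} (𝔐 : MackeyCover 𝔈 m)
         {t} (C : MackeyFunctor (MackeyCover.system 𝔐) t) where
  open TopologicalGroup G using (group)
  open MackeyCover 𝔐
  private
    module 𝔈 = Spectrum 𝔈
    module 𝔐 = MackeySystem system
    module C = MackeyFunctor C
    module ♭ = _⊑_ ♭-⊑
    module F = RICFunctor (inflation 𝔐 C)

    total normal : 𝔈.Elem → 𝔐.Elem
    total  ((H , V) , b) = H , ♭.Base-⊆ (V , b)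
    normal ((H , V) , b) = V , proj₂ (𝔐.Ind.⊆-Base (Ext-⊆ (V , b) b))

    normal-Ind : ∀ x → proj₁ (normal x) ∈ 𝔐.Ind (proj₁ (total x))
    normal-Ind ((H , V) , b) = Ext-⊆ (V , b) b

    Φ : ∀ x → Pred (TAb.Carrier (F.obj x)) t
    Φ = inductionImage 𝔐 C

    Φ-isSubgroup : ∀ x → IsSubgroup (TAb.group (F.obj x)) (Φ x)
    Φ-isSubgroup x = image-isSubgroup (C.ind (total x) (normal x) (normal-Ind x))

  inductionImage-con : ∀ g x y p {c} → c ∈ Φ x → ⟦ F.con g x y p ⟧ c ∈ Φ y
  inductionImage-con g x y p {c} (d , c≈) = ⟦ C.con g (normal x) (normal y) (proj₂ p) ⟧ d ,
    trans (Hom.⟦⟧-cong (F.con g x y p) c≈)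
      (C.con-ind g (total x) (normal x) (total y) (normal y)
        (normal-Ind x) (normal-Ind y) (proj₂ p) (proj₁ p) d)
    where open TAb (F.obj y)

  inductionImage-ind : ∀ x y p {c} → c ∈ Φ y → ⟦ F.ind x y p ⟧ c ∈ Φ x
  inductionImage-ind x y p {c} (d , c≈) = ⟦ C.ind (normal x) (normal y) W∈V ⟧ d ,
    (begin
      ⟦ F.ind x y p ⟧ c
        ≈⟨ Hom.⟦⟧-cong (F.ind x y p) c≈ ⟩
      ⟦ F.ind x y p ∘ₕ C.ind (total y) (normal y) (normal-Ind y) ⟧ d
        ≈⟨ C.ind-ind (total x) (total y) (normal y) _ _ W∈H d ⟩
      ⟦ C.ind (total x) (normal y) W∈H ⟧ d
        ≈⟨ sym (C.ind-ind (total x) (normal x) (normal y) (normal-Ind x) W∈V W∈H d) ⟩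
      ⟦ C.ind (total x) (normal x) (normal-Ind x) ∘ₕ C.ind (normal x) (normal y) W∈V ⟧ d
        ∎)
    where
    open TAb (F.obj x) using (setoid; sym)
    open SetoidReasoning setoid
    W∈V : proj₁ (normal y) ∈ 𝔐.Ind (proj₁ (normal x))
    W∈V = Ind-snd p
    W∈H : proj₁ (normal y) ∈ 𝔐.Ind (proj₁ (total x))
    W∈H = 𝔐.Ind.transitive (normal-Ind x) W∈V

  inductionImage-res : ∀ y x p {c} → c ∈ Φ x → ⟦ F.res y x p ⟧ c ∈ Φ y
  inductionImage-res y@((I , W) , b′) x@((H , V) , b) p {c} (d , c≈) =
    Φy.resp (sym (trans (Hom.⟦⟧-cong (F.res y x p) c≈)
              (C.mackeyFormula (total x) (total y) (normal x) I∈H V∈H n reps d)))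
      (sum-∈ (F.obj y) (Φ-isSubgroup y) n _ summand-∈)
    where
    open TAb (F.obj y) using (sym; trans)
    module Φy = IsSubgroup (Φ-isSubgroup y)

    I∈H : I ∈ 𝔐.Res H
    I∈H = ♭.Res-⊆ (_ , _ , p)

    V∈H : V ∈ 𝔐.Ind H
    V∈H = normal-Ind x

    n    = proj₁ (𝔐.finite I∈H V∈H)
    reps = proj₂ (𝔐.finite I∈H V∈H)

    W≐V : W ≐ₛ V
    W≐V = 𝔈.Res-≐ p

    W≐I∩ʰV : ∀ {h} → h ∈ₛ H → W ≐ₛ I ∩ₛ conjₛ h V
    W≐I∩ʰV h∈ =
      (λ w → IsClosedNormalSubgroup.≤ (𝔈.Base-normal b′) w , proj₂ ʰV≐V (proj₁ W≐V w)) ,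
      (λ (_ , v) → proj₂ W≐V (proj₁ ʰV≐V v))
      where ʰV≐V = conjₛ-normal {G = G} (𝔈.Base-normal b) h∈

    summand-∈ : ∀ k → _ ∈ Φ y
    summand-∈ k = _ , ind-≐ C.functor (total y) _ (normal y) _ (normal-Ind y)
                        (W≐I∩ʰV (proj₂ (Bijection.to reps k))) _

  inductionImage-isSubfunctor : IsSubfunctor (inflation 𝔐 C) Φ
  inductionImage-isSubfunctor = record
    { isSubgroup = Φ-isSubgroup
    ; res-stable = inductionImage-res
    ; ind-stable = inductionImage-ind
    ; con-stable = inductionImage-con
    }

module _ {a} {G : TopologicalGroup a} {e} (𝔈 : Spectrum G e) where

  -- F is kept abstract, since unfolding inflations under quotient makes
  -- conversion checking very slow.
  quotient-isRepresentation :
    ∀ {t} {F : RICFunctor (Spectrum.ricDomain 𝔈) t} {Φ}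
    (B : RICFunctor (Spectrum.♭-ricDomain 𝔈) t) →
    F ≡ inflate 𝔈 B → (S : IsSubfunctor F Φ) → IsRepresentation 𝔈 (quotient F S)
  quotient-isRepresentation {Φ = Φ} B refl S = B , Φ , S , refl

proposition3p3p8 : ∀ {a e m t} (G : TopologicalGroup a) (𝔈 : Spectrum G e) (𝔐 : MackeyCover 𝔈 m)
    (C : MackeyFunctor (MackeyCover.system 𝔐) t) →
    Σ[ S ∈ IsSubfunctor (inflation 𝔐 C) (inductionImage 𝔐 C) ]
    IsRepresentation 𝔈 (quotient (inflation 𝔐 C) S)
proposition3p3p8 G 𝔈 𝔐 C =
  S , quotient-isRepresentation 𝔈 {F = inflation 𝔐 C}
        (restrict {𝔖 = Spectrum.♭-ricDomain 𝔈}
                  {MackeySystem.ricDomain (MackeyCover.system 𝔐)}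
                  (MackeyCover.♭-⊑ 𝔐) (MackeyFunctor.functor C))
        refl S
  where
  S : IsSubfunctor (inflation 𝔐 C) (inductionImage 𝔐 C)
  S = inductionImage-isSubfunctor 𝔐 C
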